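{- For every positive integer $h$, the edge-forwarding index of the multiplicative circulant graph $\Gamma_{3^h}=MC(3^h)$ satisfies $$2\cdot 3^{h-1}\leq \pi(\Gamma_{3^h})\leq 3^{h-1}(3+2h)-4h+1.$$
   Context: For integers $m>1$, $h>0$, $MC(m^h)$ is the graph with vertex set $\mathbb{Z}_{m^h}$ in which distinct vertices $x,y$ are adjacent iff $x-y\equiv \pm m^i \pmod{m^h}$ for some $i\in\{0,\ldots,h-1\}$. For a connected graph $\Gamma$ on $N$ vertices, a routing $R$ is a choice of one path $R(x,y)$ from $x$ to $y$ for each of the $N(N-1)$ ordered pairs $(x,y)$ of distinct vertices. The load $\pi_e(\Gamma,R)$ of an edge $e$ is the number of paths of $R$ passing through $e$; $\pi(\Gamma,R)=\max_e \pi_e(\Gamma,R)$; and the edge-forwarding index is $\pi(\Gamma)=\min_R \pi(\Gamma,R)$ over all routings $R$ of $\Gamma$. -}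

module Defs where

open import Data.Nat using (ℕ; zero; suc; _+_; _*_; _^_; _<_; _≤_; NonZero)
open import Data.Nat.Properties using (m^n≢0)
open import Data.Nat.DivMod using (_%_)
open import Data.Fin using (Fin; toℕ; _≟_)
open import Data.List using (List; []; _∷_; head; last; map; allFin)
open import Data.Nat.ListAction using (sum)
open import Data.List.Relation.Unary.Unique.Propositional using (Unique)
open import Data.Maybe using (Maybe; just)
open import Data.Product using (Σ; ∃; ∃-syntax; _×_; _,_; proj₁)
open import Data.Unit using (⊤)
open import Data.Sum using (_⊎_)
open import Relation.Binary.PropositionalEquality using (_≡_; _≢_)
open import Relation.Nullary using (yes; no)
open import Relation.Nullary.Decidable using (⌊_⌋)
open import Data.Bool using (Bool; true; false; if_then_else_; _∨_; _∧_)

Graph : ℕ → Set₁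
Graph n = Fin n → Fin n → Set

-- Multiplicative circulant graph MC(m^h) on Z_{m^h} (represented by Fin (m^h)):
-- distinct x, y adjacent iff x - y ≡ ± m^i (mod m^h) for some i < h.
MC : (m h : ℕ) → .{{NonZero m}} → Graph (m ^ h)
MC m h x y =
  (x ≢ y) ×
  (∃[ i ] (i < h) ×
     (((toℕ y + m ^ i) % (m ^ h)) {{m^n≢0 m h}} ≡ toℕ x
      ⊎ ((toℕ x + m ^ i) % (m ^ h)) {{m^n≢0 m h}} ≡ toℕ y))

module _ {n : ℕ} (Γ : Graph n) where

  IsWalk : List (Fin n) → Set
  IsWalk []           = ⊤
  IsWalk (u ∷ [])     = ⊤
  IsWalk (u ∷ v ∷ vs) = Γ u v × IsWalk (v ∷ vs)

  Path : Fin n → Fin n → Set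
  Path x y = Σ (List (Fin n)) λ p →
    (head p ≡ just x) × (last p ≡ just y) × IsWalk p × Unique p

  Routing : Set
  Routing = (x y : Fin n) → x ≢ y → Path x y

traverses : {n : ℕ} → Fin n → Fin n → List (Fin n) → Bool
traverses u v []           = false
traverses u v (a ∷ [])     = false
traverses u v (a ∷ b ∷ bs) =
  (⌊ a ≟ u ⌋ ∧ ⌊ b ≟ v ⌋) ∨ (⌊ a ≟ v ⌋ ∧ ⌊ b ≟ u ⌋) ∨ traverses u v (b ∷ bs)

module _ {n : ℕ} {Γ : Graph n} where

  pairUses : Routing Γ → Fin n → Fin n → Fin n → Fin n → ℕ
  pairUses R u v x y with x ≟ y
  ... | yes _ = 0
  ... | no x≢y = if traverses u v (proj₁ (R x y x≢y)) then 1 else 0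

  load : Routing Γ → Fin n → Fin n → ℕ
  load R u v = sum (map (λ x → sum (map (λ y → pairUses R u v x y) (allFin n))) (allFin n))

-- π(Γ,R) = max over edges of the load; "π(Γ,R) ≤ k" and "k ≤ π(Γ,R)"
MaxLoad≤ : {n : ℕ} (Γ : Graph n) → Routing Γ → ℕ → Set
MaxLoad≤ {n} Γ R k = (u v : Fin n) → Γ u v → load R u v ≤ k

MaxLoad≥ : {n : ℕ} (Γ : Graph n) → Routing Γ → ℕ → Set
MaxLoad≥ {n} Γ R k = Σ (Fin n) λ u → Σ (Fin n) λ v → Γ u v × (k ≤ load R u v)

-- k is the edge-forwarding index π(Γ) = min_R max_e π_e(Γ,R):
-- some routing attains max load ≤ k, and every routing has max load ≥ k.
IsEdgeForwardingIndex : {n : ℕ} (Γ : Graph n) → ℕ → Set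
IsEdgeForwardingIndex Γ k = (∃[ R ] MaxLoad≤ Γ R k) × (∀ R → MaxLoad≥ Γ R k)

{-# OPTIONS --safe #-}

-- The edge-forwarding index is exactly 2·3^(h-1).
-- Upper bound: route x to y by correcting x modulo 3, 9, 27, …, moving by 0 or
-- ±3^i at stage i.  A path crossing an edge of class i from u to v does so at
-- stage i, so x is one of the 3^i vertices from which the first i stages can
-- reach u, and y one of the 3^(h-1-i) that the remaining stages can reach from v;
-- with the two directions, the edge carries at most 2·3^i·3^(h-1-i) paths.
-- Lower bound: only edges {u , u+1} change the residue modulo 3, hence each of
-- the 3^h·2·3^(h-1) ordered pairs of vertices incongruent modulo 3 loads one of
-- these 3^h edges.
module Submission where

open import Defs
open import Data.Nat using (ℕ; zero; suc; _+_; _*_; _∸_; _^_; _≤_; _<_; NonZero; z≤n; s≤s; _⊔_)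
open import Data.Nat.Properties hiding (_≟_)
import Data.Nat.Divisibility as ℕ
open import Data.Nat.DivMod using (_%_)
open import Data.Nat.ListAction using (sum)
open import Data.Nat.ListAction.Properties using (sum-++)
open import Data.Nat.Tactic.RingSolver using () renaming (solve-∀ to solveℕ-∀)
open import Data.Integer as ℤ using (ℤ; +_)
import Data.Integer.Properties as ℤ
open import Data.Integer.DivMod using (_%ℕ_; _/ℕ_; n%ℕd<d; a≡a%ℕn+[a/ℕn]*n)
open import Data.Integer.Divisibility.Signed using (_∣_; divides; _∣?_; ∣ᵤ⇒∣; ∣⇒∣ᵤ; ∣-trans; ∣m∣n⇒∣m+n; ∣m⇒∣-m)
open import Data.Integer.Tactic.RingSolver using (solve-∀)
open import Data.Bool using (true; false; T; _∧_; if_then_else_)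
open import Data.Bool.Properties using (T-∧; T-∨)
open import Data.Fin using (Fin; toℕ; fromℕ<; _≟_)
open import Data.Fin.Properties using (toℕ-fromℕ<; toℕ<n; toℕ-injective; any?)
open import Data.List using (List; []; _∷_; _++_; length; map; allFin; downFrom; last; cartesianProduct)
open import Data.List.Properties using (length-++; length-map; length-downFrom; length-removeAt′; length-tabulate; map-++; map-∘)
open import Data.List.Membership.Propositional using (_∈_)
open import Data.List.Membership.Propositional.Properties using (∈-++⁺ˡ; ∈-++⁺ʳ; ∈-cartesianProduct⁺; ∈-allFin)
open import Data.List.Relation.Unary.Any using (here; there; _─_; index)
open import Data.List.Relation.Unary.All as All using (All; []; _∷_)
open import Data.List.Relation.Unary.AllPairs using ([]; _∷_)
open import Data.List.Relation.Unary.Unique.Propositional using (Unique)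
open import Data.List.Relation.Unary.Unique.Propositional.Properties using (allFin⁺; cartesianProduct⁺)
open import Data.Maybe using (just)
open import Data.Product using (∃-syntax; _×_; _,_; proj₁; proj₂)
open import Data.Sum using (_⊎_; inj₁; inj₂; [_,_]′)
open import Function using (_∘_; Equivalence)
open import Relation.Binary.Definitions using (tri<; tri≈; tri>)
open import Relation.Binary.PropositionalEquality using (_≡_; _≢_; refl; sym; trans; cong; cong₂; subst; module ≡-Reasoning)
open import Relation.Nullary using (¬_; Dec; yes; no; contradiction)
open import Relation.Nullary.Decidable using (⌊_⌋; map′; toWitness; fromWitness)

-- Sums over lists

∑ : {A : Set} → List A → (A → ℕ) → ℕ
∑ xs f = sum (map f xs)

∑-mono : {A : Set} (xs : List A) {f g : A → ℕ} → (∀ x → f x ≤ g x) → ∑ xs f ≤ ∑ xs g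
∑-mono []       f≤g = z≤n
∑-mono (x ∷ xs) f≤g = +-mono-≤ (f≤g x) (∑-mono xs f≤g)

∑-const : {A : Set} (xs : List A) (c : ℕ) → ∑ xs (λ _ → c) ≡ length xs * c
∑-const []       c = refl
∑-const (x ∷ xs) c = cong₂ _+_ refl (∑-const xs c)

∑-+ : {A : Set} (xs : List A) (f g : A → ℕ) → ∑ xs (λ x → f x + g x) ≡ ∑ xs f + ∑ xs g
∑-+ []       f g = refl
∑-+ (x ∷ xs) f g rewrite ∑-+ xs f g = interchange (f x) (g x) (∑ xs f) (∑ xs g)
  where
  interchange : ∀ a b c d → a + b + (c + d) ≡ a + c + (b + d)
  interchange = solveℕ-∀

∑-swap : {A B : Set} (xs : List A) (ys : List B) (f : A → B → ℕ) →
         ∑ xs (λ x → ∑ ys (f x)) ≡ ∑ ys (λ y → ∑ xs (λ x → f x y))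
∑-swap []       ys f = sym (trans (∑-const ys 0) (*-zeroʳ (length ys)))
∑-swap (x ∷ xs) ys f = trans (cong₂ _+_ refl (∑-swap xs ys f)) (sym (∑-+ ys (f x) _))

∑-cartesianProduct : {A B : Set} (xs : List A) (ys : List B) (f : A × B → ℕ) →
  ∑ xs (λ x → ∑ ys (λ y → f (x , y))) ≡ ∑ (cartesianProduct xs ys) f
∑-cartesianProduct []       ys f = refl
∑-cartesianProduct (x ∷ xs) ys f = begin
  ∑ ys (λ y → f (x , y)) + ∑ xs (λ x → ∑ ys (λ y → f (x , y)))
    ≡⟨ cong₂ _+_ (cong sum (map-∘ ys)) (∑-cartesianProduct xs ys f) ⟩
  sum (map f row) + sum (map f rest)
    ≡⟨ sum-++ (map f row) (map f rest) ⟨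
  sum (map f row ++ map f rest)
    ≡⟨ cong sum (map-++ f row rest) ⟨
  ∑ (row ++ rest) f ∎
  where
  open ≡-Reasoning
  row  = map (x ,_) ys
  rest = cartesianProduct xs ys

length-cartesianProduct : {A B : Set} (xs : List A) (ys : List B) →
  length (cartesianProduct xs ys) ≡ length xs * length ys
length-cartesianProduct []       ys = refl
length-cartesianProduct (x ∷ xs) ys = trans (length-++ (map (x ,_) ys))
  (cong₂ _+_ (length-map (x ,_) ys) (length-cartesianProduct xs ys))

≤∑ : {A : Set} {xs : List A} (f : A → ℕ) {x : A} → x ∈ xs → f x ≤ ∑ xs f
≤∑ f (here refl) = m≤m+n _ _
≤∑ f (there x∈)  = ≤-trans (≤∑ f x∈) (m≤n+m _ _)

∈-─ : {A : Set} {x y : A} {xs : List A} (x∈ : x ∈ xs) → y ∈ xs → x ≢ y → y ∈ (xs ─ x∈)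
∈-─ (here refl) (here refl) x≢y = contradiction refl x≢y
∈-─ (here refl) (there y∈)  x≢y = y∈
∈-─ (there x∈)  (here refl) x≢y = here refl
∈-─ (there x∈)  (there y∈)  x≢y = there (∈-─ x∈ y∈ x≢y)

-- Each `x` of value 1 uses up one entry of `L`, and since `xs` has no repetitions, deleting that
-- entry spares those needed later. `L` itself may contain repetitions, so any overcount of the
-- support will do.
∑-support : {A : Set} {xs : List A} → Unique xs → (f : A → ℕ) (L : List A) →
  (∀ {x} → x ∈ xs → f x ≡ 0 ⊎ (f x ≡ 1 × x ∈ L)) → ∑ xs f ≤ length L
∑-support [] f L supp = z≤n
∑-support {xs = x ∷ xs} (x∉ ∷ uniq) f L supp with supp (here refl)
... | inj₁ fx≡0 rewrite fx≡0 = ∑-support uniq f L (supp ∘ there)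
... | inj₂ (fx≡1 , x∈L) rewrite fx≡1 | length-removeAt′ L (index x∈L) =
  s≤s (∑-support uniq f (L ─ x∈L) λ y∈ → [ inj₁ , (λ (fy≡1 , y∈L) → inj₂ (fy≡1 , ∈-─ x∈L y∈L (All.lookup x∉ y∈))) ]′ (supp (there y∈)))

-- If all values were below c, each would leave a deficit of at least 1.
average≤max : ∀ {n} (f : Fin n → ℕ) {c} → 0 < n → n * c ≤ ∑ (allFin n) f → ∃[ u ] c ≤ f u
average≤max {n} f {c} 0<n avg with any? (λ u → c ≤? f u)
... | yes max = max
... | no  small = contradiction 0<n (<⇒≱ (s≤s (+-cancelʳ-≤ (∑ (allFin n) f) n 0 deficit)))
  where
  open ≤-Reasoning
  len = length-tabulate {n = n} (λ i → i)
  deficit : n + ∑ (allFin n) f ≤ ∑ (allFin n) f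
  deficit = begin
    n + ∑ (allFin n) f
      ≡⟨ cong (_+ ∑ (allFin n) f) (trans (∑-const (allFin n) 1) (trans (*-identityʳ _) len)) ⟨
    ∑ (allFin n) (λ _ → 1) + ∑ (allFin n) f
      ≡⟨ ∑-+ (allFin n) (λ _ → 1) f ⟨
    ∑ (allFin n) (λ u → suc (f u))
      ≤⟨ ∑-mono (allFin n) (λ u → ≰⇒> (λ c≤ → small (u , c≤))) ⟩
    ∑ (allFin n) (λ _ → c)
      ≡⟨ trans (∑-const (allFin n) c) (cong (_* c) len) ⟩
    n * c
      ≤⟨ avg ⟩
    ∑ (allFin n) f ∎

-- Congruences

infix 4 _≡_⟨mod_⟩
-- A record rather than an abbreviation, because `x` and `y` could not be inferred from their
-- difference alone. Over the integers, moves by -3^i need no truncated subtraction.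
record _≡_⟨mod_⟩ (x y : ℤ) (m : ℕ) : Set where
  constructor mod
  field
    ∣-difference : + m ∣ x ℤ.- y
open _≡_⟨mod_⟩

mod? : ∀ x y m → Dec (x ≡ y ⟨mod m ⟩)
mod? x y m = map′ mod ∣-difference (+ m ∣? x ℤ.- y)

mod-refl : ∀ {m x} → x ≡ x ⟨mod m ⟩
mod-refl {x = x} = mod (divides (+ 0) (ℤ.+-inverseʳ x))

mod-sym : ∀ {m x y} → x ≡ y ⟨mod m ⟩ → y ≡ x ⟨mod m ⟩
mod-sym {m} {x} {y} (mod p) = mod (subst (+ m ∣_) (eq x y) (∣m⇒∣-m p))
  where
  eq : ∀ x y → ℤ.- (x ℤ.- y) ≡ y ℤ.- x
  eq = solve-∀

mod-trans : ∀ {m x y z} → x ≡ y ⟨mod m ⟩ → y ≡ z ⟨mod m ⟩ → x ≡ z ⟨mod m ⟩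
mod-trans {m} {x} {y} {z} (mod p) (mod q) = mod (subst (+ m ∣_) (eq x y z) (∣m∣n⇒∣m+n p q))
  where
  eq : ∀ x y z → (x ℤ.- y) ℤ.+ (y ℤ.- z) ≡ x ℤ.- z
  eq = solve-∀

mod-+ʳ : ∀ {m x y} z → x ≡ y ⟨mod m ⟩ → x ℤ.+ z ≡ y ℤ.+ z ⟨mod m ⟩
mod-+ʳ {m} {x} {y} z (mod p) = mod (subst (+ m ∣_) (eq x y z) p)
  where
  eq : ∀ x y z → x ℤ.- y ≡ (x ℤ.+ z) ℤ.- (y ℤ.+ z)
  eq = solve-∀

mod-%ℕ : ∀ z n .{{_ : NonZero n}} → + (z %ℕ n) ≡ z ⟨mod n ⟩
mod-%ℕ z n = mod (divides (ℤ.- (z /ℕ n))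
  (trans (cong (λ w → + (z %ℕ n) ℤ.- w) (a≡a%ℕn+[a/ℕn]*n z n)) (eq (+ (z %ℕ n)) (z /ℕ n) (+ n))))
  where
  eq : ∀ r q n → r ℤ.- (r ℤ.+ q ℤ.* n) ≡ ℤ.- q ℤ.* n
  eq = solve-∀

-- The difference is a multiple of `n` of absolute value at most `a ⊔ b`, hence below `n`, hence
-- zero.
mod-< : ∀ {n a b} → a < n → b < n → + a ≡ + b ⟨mod n ⟩ → a ≡ b
mod-< {n} {a} {b} a<n b<n (mod p) = ℤ.+-injective (ℤ.i-j≡0⇒i≡j (+ a) (+ b) (ℤ.∣i∣≡0⇒i≡0 (small _ (∣⇒∣ᵤ p) bound)))
  where
  bound : ℤ.∣ + a ℤ.- + b ∣ < n
  bound = ≤-<-trans (subst (λ z → ℤ.∣ z ∣ ≤ a ⊔ b) (sym (ℤ.m-n≡m⊖n a b)) (ℤ.∣m⊝n∣≤m⊔n a b)) (⊔-lub a<n b<n)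
  small : ∀ d → n ℕ.∣ d → d < n → d ≡ 0
  small zero    n∣d d<n = refl
  small (suc d) n∣d d<n = contradiction n∣d (ℕ.>⇒∤ d<n)

3^-weaken : ∀ {i j x y} → i ≤ j → x ≡ y ⟨mod 3 ^ j ⟩ → x ≡ y ⟨mod 3 ^ i ⟩
3^-weaken {i} {j} i≤j (mod p) = mod (∣-trans (∣ᵤ⇒∣ 3^i∣3^j) p)
  where
  3^i∣3^j : 3 ^ i ℕ.∣ 3 ^ j
  3^i∣3^j = subst (3 ^ i ℕ.∣_)
    (trans (sym (^-distribˡ-+-* 3 i (j ∸ i))) (cong (3 ^_) (m+[n∸m]≡n i≤j))) (ℕ.m∣m*n (3 ^ (j ∸ i)))

-- With x - y = q m, the balanced ternary digit of q decides: remainder 0 needs no correction, 1 is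
-- cancelled by subtracting m, and 2, read as -1, by adding m, which carries into the quotient
-- `k + 1`.
trisect : ∀ {m x y} → x ≡ y ⟨mod m ⟩ →
  x ≡ y ⟨mod 3 * m ⟩ ⊎ x ℤ.+ + m ≡ y ⟨mod 3 * m ⟩ ⊎ x ℤ.- + m ≡ y ⟨mod 3 * m ⟩
trisect {m} {x} {y} (mod (divides q eq)) = go (q %ℕ 3) (n%ℕd<d q 3) (trans eq (cong (ℤ._* + m) (a≡a%ℕn+[a/ℕn]*n q 3)))
  where
  k = q /ℕ 3
  3m : + (3 * m) ≡ + 3 ℤ.* + m
  3m = ℤ.pos-* 3 m
  swap₁ : ∀ x y z → x ℤ.+ z ℤ.- y ≡ x ℤ.- y ℤ.+ z
  swap₁ = solve-∀
  swap₂ : ∀ x y z → x ℤ.- z ℤ.- y ≡ x ℤ.- y ℤ.- z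
  swap₂ = solve-∀
  r0 : ∀ k m → (+ 0 ℤ.+ k ℤ.* + 3) ℤ.* m ≡ k ℤ.* (+ 3 ℤ.* m)
  r0 = solve-∀
  r1 : ∀ k m → (+ 1 ℤ.+ k ℤ.* + 3) ℤ.* m ℤ.- m ≡ k ℤ.* (+ 3 ℤ.* m)
  r1 = solve-∀
  r2 : ∀ k m → (+ 2 ℤ.+ k ℤ.* + 3) ℤ.* m ℤ.+ m ≡ (k ℤ.+ + 1) ℤ.* (+ 3 ℤ.* m)
  r2 = solve-∀
  go : ∀ r → r < 3 → x ℤ.- y ≡ (+ r ℤ.+ k ℤ.* + 3) ℤ.* + m →
    x ≡ y ⟨mod 3 * m ⟩ ⊎ x ℤ.+ + m ≡ y ⟨mod 3 * m ⟩ ⊎ x ℤ.- + m ≡ y ⟨mod 3 * m ⟩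
  go 0 _ e = inj₁ (mod (divides k (trans e (trans (r0 k (+ m)) (cong (k ℤ.*_) (sym 3m))))))
  go 1 _ e = inj₂ (inj₂ (mod (divides k (trans (swap₂ x y (+ m)) (trans (cong (ℤ._- + m) e) (trans (r1 k (+ m)) (cong (k ℤ.*_) (sym 3m))))))))
  go 2 _ e = inj₂ (inj₁ (mod (divides (k ℤ.+ + 1) (trans (swap₁ x y (+ m)) (trans (cong (ℤ._+ + m) e) (trans (r2 k (+ m)) (cong ((k ℤ.+ + 1) ℤ.*_) (sym 3m))))))))
  go (suc (suc (suc _))) (s≤s (s≤s (s≤s ()))) _

-- Routes in MC(3^h)

module Circulant (h : ℕ) where

  private
    instance
      3^h≢0 : NonZero (3 ^ h)
      3^h≢0 = m^n≢0 3 h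

  Vertex : Set
  Vertex = Fin (3 ^ h)

  vertex : ℤ → Vertex
  vertex z = fromℕ< (n%ℕd<d z (3 ^ h))

  ⟦_⟧ : Vertex → ℤ
  ⟦ a ⟧ = + toℕ a

  ⟦vertex⟧ : ∀ z → ⟦ vertex z ⟧ ≡ z ⟨mod 3 ^ h ⟩
  ⟦vertex⟧ z rewrite toℕ-fromℕ< (n%ℕd<d z (3 ^ h)) = mod-%ℕ z (3 ^ h)

  ⟦⟧-injective : ∀ {a b} → ⟦ a ⟧ ≡ ⟦ b ⟧ ⟨mod 3 ^ h ⟩ → a ≡ b
  ⟦⟧-injective {a} {b} p = toℕ-injective (mod-< (toℕ<n a) (toℕ<n b) p)

  -- Moves by powers of 3 and the class of an edge

  up down : ℕ → Vertex → Vertex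
  up   i a = vertex (⟦ a ⟧ ℤ.+ + (3 ^ i))
  down i a = vertex (⟦ a ⟧ ℤ.- + (3 ^ i))

  toℕ-up : ∀ i a → toℕ (up i a) ≡ (toℕ a + 3 ^ i) % (3 ^ h)
  toℕ-up i a = toℕ-fromℕ< (n%ℕd<d (⟦ a ⟧ ℤ.+ + (3 ^ i)) (3 ^ h))

  up-down : ∀ i a → up i (down i a) ≡ a
  up-down i a = ⟦⟧-injective (mod-trans (⟦vertex⟧ _)
    (subst (⟦ down i a ⟧ ℤ.+ p ≡_⟨mod 3 ^ h ⟩) (cancel ⟦ a ⟧ p) (mod-+ʳ p (⟦vertex⟧ (⟦ a ⟧ ℤ.- p)))))
    where
    p = + (3 ^ i)
    cancel : ∀ x p → x ℤ.- p ℤ.+ p ≡ x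
    cancel = solve-∀

  down-up : ∀ i a → down i (up i a) ≡ a
  down-up i a = ⟦⟧-injective (mod-trans (⟦vertex⟧ _)
    (subst (⟦ up i a ⟧ ℤ.- p ≡_⟨mod 3 ^ h ⟩) (cancel ⟦ a ⟧ p) (mod-+ʳ (ℤ.- p) (⟦vertex⟧ (⟦ a ⟧ ℤ.+ p)))))
    where
    p = + (3 ^ i)
    cancel : ∀ x p → x ℤ.+ p ℤ.- p ≡ x
    cancel = solve-∀

  -- `back` ends at `a` instead of starting there, so reversing a step merely exchanges the
  -- constructors.
  data Step (i : ℕ) : Vertex → Vertex → Set where
    forth : ∀ a → Step i a (up i a)
    back  : ∀ a → Step i (up i a) a

  step-sym : ∀ {i a b} → Step i a b → Step i b a
  step-sym (forth a) = back a
  step-sym (back a)  = forth a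

  -- An edge of class i has level i, so that its endpoints determine its class.
  record Level (i : ℕ) (a b : Vertex) : Set where
    constructor level
    field
      agree  : ⟦ a ⟧ ≡ ⟦ b ⟧ ⟨mod 3 ^ i ⟩
      differ : ¬ ⟦ a ⟧ ≡ ⟦ b ⟧ ⟨mod 3 ^ suc i ⟩
  open Level

  level-sym : ∀ {i a b} → Level i a b → Level i b a
  level-sym (level p ¬p) = level (mod-sym p) (¬p ∘ mod-sym)

  -- The level is the 3-adic valuation of the difference: for two unequal levels, `agree` at the
  -- larger refutes `differ` at the smaller.
  level-unique : ∀ {i j a b} → Level i a b → Level j a b → i ≡ j
  level-unique {i} {j} (level p ¬p) (level q ¬q) with <-cmp i j
  ... | tri< i<j _ _ = contradiction (3^-weaken i<j q) ¬p
  ... | tri≈ _ i≡j _ = i≡j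
  ... | tri> _ _ j<i = contradiction (3^-weaken j<i p) ¬q

  up-level : ∀ {i} a → i < h → Level i (up i a) a
  up-level {i} a i<h = level near far
    where
    p = + (3 ^ i)
    -- Reduction modulo 3^h is invisible modulo 3^j for j ≤ h. `far` takes j = i + 1, which is where
    -- `i < h` matters.
    residue : ∀ {j} → j ≤ h → ⟦ up i a ⟧ ≡ ⟦ a ⟧ ℤ.+ p ⟨mod 3 ^ j ⟩
    residue j≤h = 3^-weaken j≤h (⟦vertex⟧ (⟦ a ⟧ ℤ.+ p))
    cancel : ∀ a p → a ℤ.+ p ℤ.- a ≡ p
    cancel = solve-∀
    near : ⟦ up i a ⟧ ≡ ⟦ a ⟧ ⟨mod 3 ^ i ⟩
    near = mod-trans (residue (<⇒≤ i<h)) (mod (divides (+ 1) (trans (cancel ⟦ a ⟧ p) (sym (ℤ.*-identityˡ p)))))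
    far : ¬ ⟦ up i a ⟧ ≡ ⟦ a ⟧ ⟨mod 3 ^ suc i ⟩
    -- Otherwise 3^(i+1) would divide the difference 3^i.
    far q = ℕ.>⇒∤ {{m^n≢0 3 i}} (^-monoʳ-< 3 (s≤s (s≤s z≤n)) (n<1+n i))
      (∣⇒∣ᵤ (subst (+ (3 ^ suc i) ∣_) (cancel ⟦ a ⟧ p) (∣-difference (mod-trans (mod-sym (residue i<h)) q))))

  step-level : ∀ {i a b} → i < h → Step i a b → Level i a b
  step-level i<h (forth a) = level-sym (up-level a i<h)
  step-level i<h (back a)  = up-level a i<h

  level⇒≢ : ∀ {i a b} → Level i a b → a ≢ b
  level⇒≢ (level _ ¬p) refl = ¬p mod-refl

  step⇒edge : ∀ {i a b} → i < h → Step i a b → MC 3 h a b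
  step⇒edge {i} {a} {b} i<h s = level⇒≢ (step-level i<h s) , i , i<h , edge s
    where
    edge : Step i a b → (toℕ b + 3 ^ i) % (3 ^ h) ≡ toℕ a ⊎ (toℕ a + 3 ^ i) % (3 ^ h) ≡ toℕ b
    edge (forth _) = inj₂ (sym (toℕ-up i a))
    edge (back _)  = inj₁ (sym (toℕ-up i b))

  edge⇒step : ∀ {a b} → MC 3 h a b → ∃[ i ] i < h × Step i a b
  edge⇒step {a} {b} (_ , i , i<h , inj₁ eq)
    with refl ← toℕ-injective (trans (toℕ-up i b) eq) = i , i<h , back b
  edge⇒step {a} {b} (_ , i , i<h , inj₂ eq)
    with refl ← toℕ-injective (trans (toℕ-up i a) eq) = i , i<h , forth a

  -- The stages form an explicit list so that one definition runs forward along `stages`, towards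
  -- targets, and backward along `downFrom`, towards sources. Coinciding endpoints are kept, which
  -- makes the length exactly a power of 3.
  fan : List ℕ → Vertex → List Vertex
  fan []       a = a ∷ []
  fan (i ∷ is) a = fan is a ++ fan is (up i a) ++ fan is (down i a)

  length-fan : ∀ is a → length (fan is a) ≡ 3 ^ length is
  length-fan []       a = refl
  length-fan (i ∷ is) a
    rewrite length-++ (fan is a) {fan is (up i a) ++ fan is (down i a)}
          | length-++ (fan is (up i a)) {fan is (down i a)}
          | length-fan is a | length-fan is (up i a) | length-fan is (down i a)
          | +-identityʳ (3 ^ length is) = refl

  fan-step : ∀ {i a b c} is → Step i a b → c ∈ fan is b → c ∈ fan (i ∷ is) a
  fan-step is (forth a) c∈ = ∈-++⁺ʳ (fan is a) (∈-++⁺ˡ c∈)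
  fan-step {i} {a} {c = c} is (back b) c∈ =
    ∈-++⁺ʳ (fan is a) (∈-++⁺ʳ (fan is (up i a)) (subst (λ d → c ∈ fan is d) (sym (down-up i b)) c∈))

  -- Trails of the greedy routing

  stages : ℕ → ℕ → List ℕ
  stages i zero    = []
  stages i (suc k) = i ∷ stages (suc i) k

  length-stages : ∀ i k → length (stages i k) ≡ k
  length-stages i zero    = refl
  length-stages i (suc k) = cong suc (length-stages (suc i) k)

  -- Trail y i k a ps: stages i, …, i+k-1 lead from a to y through the further vertices ps.
  data Trail (y : Vertex) : ℕ → ℕ → Vertex → List Vertex → Set where
    done : ∀ {i} → Trail y i 0 y []
    stay : ∀ {i k a ps} → Trail y (suc i) k a ps → Trail y i (suc k) a ps
    move : ∀ {i k a b ps} → i < h → Step i a b → Trail y (suc i) k b ps → Trail y i (suc k) a (b ∷ ps)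

  -- The invariant is agreement with `y` modulo 3^i. `trisect` picks the move that raises it to
  -- 3^(i+1), and once i = h agreement is equality.
  trail : ∀ y i k a → i + k ≡ h → ⟦ a ⟧ ≡ ⟦ y ⟧ ⟨mod 3 ^ i ⟩ → ∃[ ps ] Trail y i k a ps
  trail y i zero a eq p
    with refl ← ⟦⟧-injective {a} {y} (subst (⟦ a ⟧ ≡ ⟦ y ⟧ ⟨mod_⟩) (cong (3 ^_) (trans (sym (+-identityʳ i)) eq)) p) = [] , done
  trail y i (suc k) a eq p = choose (trisect p)
    where
    eq′ = trans (sym (+-suc i k)) eq
    i<h = m+n≤o⇒m≤o (suc i) (≤-reflexive eq′)
    via : ∀ b {z} → Step i a b → ⟦ b ⟧ ≡ z ⟨mod 3 ^ h ⟩ → z ≡ ⟦ y ⟧ ⟨mod 3 ^ suc i ⟩ → ∃[ ps ] Trail y i (suc k) a ps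
    via b s q r = let ps , t = trail y (suc i) k b eq′ (mod-trans (3^-weaken i<h q) r)
                      in b ∷ ps , move i<h s t
    choose : ⟦ a ⟧ ≡ ⟦ y ⟧ ⟨mod 3 ^ suc i ⟩ ⊎ ⟦ a ⟧ ℤ.+ + (3 ^ i) ≡ ⟦ y ⟧ ⟨mod 3 ^ suc i ⟩ ⊎ ⟦ a ⟧ ℤ.- + (3 ^ i) ≡ ⟦ y ⟧ ⟨mod 3 ^ suc i ⟩ →
      ∃[ ps ] Trail y i (suc k) a ps
    choose (inj₁ q)        = let ps , t = trail y (suc i) k a eq′ q in ps , stay t
    choose (inj₂ (inj₁ q)) = via (up i a) (forth a) (⟦vertex⟧ _) q
    -- `back` starts at a vertex of the form `up i c`; taking c = `down i a` makes it start at `a`.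
    choose (inj₂ (inj₂ q)) = via (down i a) (subst (λ c → Step i c (down i a)) (up-down i a) (back _)) (⟦vertex⟧ _) q

  -- Moves at stage i or later change a vertex by multiples of 3^i, so the residue modulo 3^i is
  -- constant along the trail up to `y`.
  trail-cong : ∀ {y i k a ps} → Trail y i k a ps → All (λ b → ⟦ b ⟧ ≡ ⟦ y ⟧ ⟨mod 3 ^ i ⟩) (a ∷ ps)
  trail-cong done = mod-refl ∷ []
  trail-cong {i = i} (stay t) = All.map (3^-weaken (n≤1+n i)) (trail-cong t)
  trail-cong {i = i} (move i<h s t) with All.map (3^-weaken (n≤1+n i)) (trail-cong t)
  ... | b≡y ∷ ps≡y = mod-trans (agree (step-level i<h s)) b≡y ∷ b≡y ∷ ps≡y

  trail-last : ∀ {y i k a ps} → Trail y i k a ps → last (a ∷ ps) ≡ just y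
  trail-last done         = refl
  trail-last (stay t)     = trail-last t
  trail-last (move _ _ t) = trail-last t

  trail-walk : ∀ {y i k a ps} → Trail y i k a ps → IsWalk (MC 3 h) (a ∷ ps)
  trail-walk done           = _
  trail-walk (stay t)       = trail-walk t
  trail-walk (move i<h s t) = step⇒edge i<h s , trail-walk t

  -- All later vertices agree with y modulo 3^(i+1); the vertex left by a move at stage i does not.
  trail-unique : ∀ {y i k a ps} → Trail y i k a ps → Unique (a ∷ ps)
  trail-unique done     = [] ∷ []
  trail-unique (stay t) = trail-unique t
  trail-unique {y} (move {i} {a = a} i<h s t) = All.map fresh (trail-cong t) ∷ trail-unique t
    where
    fresh : ∀ {c} → ⟦ c ⟧ ≡ ⟦ y ⟧ ⟨mod 3 ^ suc i ⟩ → a ≢ c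
    fresh a≡y refl = differ (step-level i<h s)
      (mod-trans a≡y (mod-sym (All.head (trail-cong t))))

  trail-fan : ∀ {y i k a ps} → Trail y i k a ps → y ∈ fan (stages i k) a
  trail-fan done         = here refl
  trail-fan (stay t)     = ∈-++⁺ˡ (trail-fan t)
  trail-fan (move {i} {k} _ s t) = fan-step (stages (suc i) k) s (trail-fan t)

  -- Steps are reversible, so undoing stages i-1, …, 0 from u yields every possible source.
  crossers : ℕ → Vertex → Vertex → List (Vertex × Vertex)
  crossers i u v = cartesianProduct (fan (downFrom i) u) (fan (stages (suc i) (h ∸ suc i)) v)

  -- The i stages before the edge and the h - 1 - i after it add up to h - 1 whatever i is, so all
  -- edge classes get the same bound.
  length-crossers : ∀ {i} u v → i < h → length (crossers i u v) ≡ 3 ^ (h ∸ 1)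
  length-crossers {i} u v i<h = begin
    length (crossers i u v)
      ≡⟨ length-cartesianProduct (fan (downFrom i) u) _ ⟩
    length (fan (downFrom i) u) * length (fan (stages (suc i) (h ∸ suc i)) v)
      ≡⟨ cong₂ _*_ (length-fan (downFrom i) u) (length-fan (stages (suc i) (h ∸ suc i)) v) ⟩
    3 ^ length (downFrom i) * 3 ^ length (stages (suc i) (h ∸ suc i))
      ≡⟨ cong₂ (λ k l → 3 ^ k * 3 ^ l) (length-downFrom i) (length-stages (suc i) (h ∸ suc i)) ⟩
    3 ^ i * 3 ^ (h ∸ suc i)
      ≡⟨ ^-distribˡ-+-* 3 i (h ∸ suc i) ⟨
    3 ^ (i + (h ∸ suc i))
      ≡⟨ cong (λ k → 3 ^ (k ∸ 1)) (m+[n∸m]≡n i<h) ⟩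
    3 ^ (h ∸ 1) ∎
    where open ≡-Reasoning

  -- The membership of `x` in the backward fan of `a` is an accumulator: each stage passed extends
  -- it by the reversed step. When the edge is met, it supplies the source half of the pair and
  -- `trail-fan` of the remaining trail the target half.
  trail-crosses : ∀ {x y i k a ps j u v} → Trail y i k a ps → i + k ≡ h → x ∈ fan (downFrom i) a →
    Level j u v → T (traverses u v (a ∷ ps)) → (x , y) ∈ crossers j u v ++ crossers j v u
  trail-crosses {i = i} (stay {k = k} t) eq x∈ lev tr =
    trail-crosses t (trans (sym (+-suc i k)) eq) (∈-++⁺ˡ x∈) lev tr
  trail-crosses {x} {y} {j = j} {u} {v} (move {i} {k} {a} {b} {ps} i<h s t) eq x∈ lev tr =
    [ (λ e → forward (both e)) , [ (λ e → backward (both e)) , onward ]′ ∘ Equivalence.to (T-∨ {⌊ a ≟ v ⌋ ∧ ⌊ b ≟ u ⌋}) ]′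
      (Equivalence.to (T-∨ {⌊ a ≟ u ⌋ ∧ ⌊ b ≟ v ⌋}) tr)
    where
    eq′ = trans (sym (+-suc i k)) eq
    both : ∀ {c d} → T (⌊ a ≟ c ⌋ ∧ ⌊ b ≟ d ⌋) → a ≡ c × b ≡ d
    both {c} {d} e = let p , q = Equivalence.to (T-∧ {⌊ a ≟ c ⌋}) e in toWitness p , toWitness q
    here-cross : Level j a b → (x , y) ∈ crossers j a b
    -- The edge has level j and the step has level i, so the crossing takes place at stage j itself.
    here-cross lev′ with refl ← level-unique lev′ (step-level i<h s) =
      ∈-cartesianProduct⁺ x∈
        (subst (λ l → y ∈ fan (stages (suc i) l) b) (sym (trans (cong (_∸ suc i) (sym eq′)) (m+n∸m≡n (suc i) k))) (trail-fan t))
    forward : a ≡ u × b ≡ v → (x , y) ∈ crossers j u v ++ crossers j v u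
    forward (refl , refl) = ∈-++⁺ˡ (here-cross lev)
    backward : a ≡ v × b ≡ u → (x , y) ∈ crossers j u v ++ crossers j v u
    backward (refl , refl) = ∈-++⁺ʳ (crossers j u v) (here-cross (level-sym lev))
    onward : T (traverses u v (b ∷ ps)) → (x , y) ∈ crossers j u v ++ crossers j v u
    onward = trail-crosses t eq′ (fan-step (downFrom i) (step-sym s) x∈) lev

  greedy : ∀ x y → ∃[ ps ] Trail y 0 h x ps
  -- Modulo 3^0 = 1 any two vertices agree, with their difference as quotient.
  greedy x y = trail y 0 h x refl (mod (divides (⟦ x ⟧ ℤ.- ⟦ y ⟧) (sym (ℤ.*-identityʳ _))))

  routing : Routing (MC 3 h)
  routing x y _ = let ps , t = greedy x y in x ∷ ps , refl , trail-last t , trail-walk t , trail-unique t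

  routing-load : MaxLoad≤ (MC 3 h) routing (2 * 3 ^ (h ∸ 1))
  routing-load u v edge = begin
    load routing u v
      ≡⟨ ∑-cartesianProduct (allFin (3 ^ h)) (allFin (3 ^ h)) uses ⟩
    ∑ (cartesianProduct (allFin (3 ^ h)) (allFin (3 ^ h))) uses
      ≤⟨ ∑-support (cartesianProduct⁺ (allFin⁺ (3 ^ h)) (allFin⁺ (3 ^ h))) uses L (λ {p} _ → supp p) ⟩
    length L
      ≡⟨ length-++ (crossers i u v) ⟩
    length (crossers i u v) + length (crossers i v u)
      ≡⟨ cong₂ _+_ (length-crossers u v i<h) (trans (length-crossers v u i<h) (sym (+-identityʳ _))) ⟩
    2 * 3 ^ (h ∸ 1) ∎
    where
    open ≤-Reasoning
    i   = proj₁ (edge⇒step edge)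
    i<h = proj₁ (proj₂ (edge⇒step edge))
    lev = step-level i<h (proj₂ (proj₂ (edge⇒step edge)))
    L   = crossers i u v ++ crossers i v u
    uses : Vertex × Vertex → ℕ
    uses (x , y) = pairUses routing u v x y
    supp : ∀ p → uses p ≡ 0 ⊎ (uses p ≡ 1 × p ∈ L)
    supp (x , y) with x ≟ y
    ... | yes _ = inj₁ refl
    ... | no  _ with traverses u v (x ∷ proj₁ (greedy x y)) in tr
    ...   | false = inj₁ refl
    -- No stage precedes the start, so the backward fan there is `x` alone.
    ...   | true  = inj₂ (refl , trail-crosses (proj₂ (greedy x y)) refl (here refl) lev (subst T (sym tr) _))

  -- Lower bound: paths that change the residue modulo 3

  Crosses : Vertex → List Vertex → Set
  Crosses u p = T (traverses u (up 0 u) p)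

  step-crosses : ∀ {a b ps} → Step 0 a b → ∃[ u ] Crosses u (a ∷ b ∷ ps)
  step-crosses (forth a) = a , Equivalence.from T-∨ (inj₁ (Equivalence.from T-∧
    (fromWitness {a? = a ≟ a} refl , fromWitness {a? = up 0 a ≟ up 0 a} refl)))
  step-crosses (back b) = b , Equivalence.from (T-∨ {⌊ up 0 b ≟ b ⌋ ∧ ⌊ b ≟ up 0 b ⌋})
    (inj₂ (Equivalence.from T-∨ (inj₁ (Equivalence.from T-∧
    (fromWitness {a? = up 0 b ≟ up 0 b} refl , fromWitness {a? = b ≟ b} refl)))))

  crosses-∷ : ∀ {u a b ps} → Crosses u (b ∷ ps) → Crosses u (a ∷ b ∷ ps)
  crosses-∷ {u} {a} {b} c = Equivalence.from (T-∨ {⌊ a ≟ u ⌋ ∧ ⌊ b ≟ up 0 u ⌋})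
    (inj₂ (Equivalence.from (T-∨ {⌊ a ≟ up 0 u ⌋ ∧ ⌊ b ≟ u ⌋}) (inj₂ c)))

  -- A step of positive class keeps the residue modulo 3, so the disagreement with `y` passes to the
  -- next vertex. It cannot persist to the end, hence a step of class 0 occurs.
  walk-crosses : ∀ {y} a ps → IsWalk (MC 3 h) (a ∷ ps) → last (a ∷ ps) ≡ just y →
    ¬ ⟦ a ⟧ ≡ ⟦ y ⟧ ⟨mod 3 ⟩ → ∃[ u ] Crosses u (a ∷ ps)
  walk-crosses a [] walk refl a≢y = contradiction mod-refl a≢y
  walk-crosses {y} a (b ∷ ps) (edge , walk) end a≢y with edge⇒step edge
  ... | zero  , i<h , s = step-crosses {ps = ps} s
  ... | suc i , i<h , s =
    let a≡b   = 3^-weaken {1} {suc i} (s≤s z≤n) (agree (step-level i<h s))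
        u , c = walk-crosses b ps walk end (a≢y ∘ mod-trans a≡b)
    in u , crosses-∷ {a = a} {b = b} {ps = ps} c

  path-crosses : ∀ {x y} (p : Path (MC 3 h) x y) → ¬ ⟦ x ⟧ ≡ ⟦ y ⟧ ⟨mod 3 ⟩ → ∃[ u ] Crosses u (proj₁ p)
  path-crosses (a ∷ ps , refl , end , walk , _) = walk-crosses a ps walk end

routing-load≥ : ∀ h (R : Routing (MC 3 (suc h))) → MaxLoad≥ (MC 3 (suc h)) R (2 * 3 ^ h)
routing-load≥ h R = let u , heavy = average≤max edgeLoad (m^n>0 3 (suc h)) total
                    in u , up 0 u , step⇒edge (s≤s z≤n) (forth u) , heavy
  where
  open Circulant (suc h)
  open ≤-Reasoning
  N  = 3 ^ suc h
  Vs = allFin N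

  length-Vs : length Vs ≡ N
  length-Vs = length-tabulate {n = N} (λ i → i)

  edgeLoad : Vertex → ℕ
  edgeLoad u = load R u (up 0 u)

  uses : Vertex → Vertex → Vertex → ℕ
  uses x y u = pairUses R u (up 0 u) x y

  same : Vertex → Vertex → ℕ
  same x y = if ⌊ mod? ⟦ x ⟧ ⟦ y ⟧ 3 ⌋ then 1 else 0

  uses≡1 : ∀ x y → ¬ ⟦ x ⟧ ≡ ⟦ y ⟧ ⟨mod 3 ⟩ → ∃[ u ] uses x y u ≡ 1
  uses≡1 x y x≢y with x ≟ y
  ... | yes refl = contradiction mod-refl x≢y
  ... | no  ne   = let u , c = path-crosses (R x y ne) x≢y in u , one c
    where
    one : ∀ {b} → T b → (if b then 1 else 0) ≡ 1
    one {true} _ = refl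

  -- Adding the indicator of congruent pairs lets the sum run over all `y`; their share is bounded
  -- by `∑-same` and cancelled in `perSource`.
  same-or-crosses : ∀ x y → 1 ≤ same x y + ∑ Vs (uses x y)
  same-or-crosses x y with mod? ⟦ x ⟧ ⟦ y ⟧ 3
  ... | yes _  = s≤s z≤n
  ... | no x≢y = let u , eq = uses≡1 x y x≢y
                 in subst (_≤ ∑ Vs (uses x y)) eq (≤∑ (uses x y) (∈-allFin u))

  -- Stages 1 to h of a trail lead from `x` to every vertex congruent to it modulo 3, so the fan
  -- over these stages bounds the size of the residue class.
  ∑-same : ∀ x → ∑ Vs (same x) ≤ 3 ^ h
  ∑-same x = begin
    ∑ Vs (same x)              ≤⟨ ∑-support (allFin⁺ N) (same x) (fan (stages 1 h) x) (λ {y} _ → supp y) ⟩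
    length (fan (stages 1 h) x) ≡⟨ length-fan (stages 1 h) x ⟩
    3 ^ length (stages 1 h)    ≡⟨ cong (3 ^_) (length-stages 1 h) ⟩
    3 ^ h                      ∎
    where
    supp : ∀ y → same x y ≡ 0 ⊎ (same x y ≡ 1 × y ∈ fan (stages 1 h) x)
    supp y with mod? ⟦ x ⟧ ⟦ y ⟧ 3
    ... | yes x≡y = inj₂ (refl , trail-fan (proj₂ (trail y 1 h x refl x≡y)))
    ... | no  _   = inj₁ refl

  perSource : ∀ x → 2 * 3 ^ h ≤ ∑ Vs (λ y → ∑ Vs (uses x y))
  -- `N` unfolds to `3 ^ h + 2 * 3 ^ h`, and the first summand pays for the congruent targets.
  perSource x = +-cancelˡ-≤ (3 ^ h) _ _ (begin
    N                                               ≡⟨ trans (∑-const Vs 1) (trans (*-identityʳ _) length-Vs) ⟨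
    ∑ Vs (λ _ → 1)                                  ≤⟨ ∑-mono Vs (same-or-crosses x) ⟩
    ∑ Vs (λ y → same x y + ∑ Vs (uses x y))         ≡⟨ ∑-+ Vs (same x) _ ⟩
    ∑ Vs (same x) + ∑ Vs (λ y → ∑ Vs (uses x y))    ≤⟨ +-monoˡ-≤ _ (∑-same x) ⟩
    3 ^ h + ∑ Vs (λ y → ∑ Vs (uses x y))            ∎)

  total : N * (2 * 3 ^ h) ≤ ∑ Vs edgeLoad
  total = begin
    N * (2 * 3 ^ h)                              ≡⟨ trans (∑-const Vs _) (cong (_* (2 * 3 ^ h)) length-Vs) ⟨
    ∑ Vs (λ _ → 2 * 3 ^ h)                       ≤⟨ ∑-mono Vs perSource ⟩
    -- The sum over `u` moves outward past `y`, then past `x`, turning crossings counted per pair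
    -- into loads counted per edge.
    ∑ Vs (λ x → ∑ Vs (λ y → ∑ Vs (uses x y)))    ≤⟨ ∑-mono Vs (λ x → ≤-reflexive (∑-swap Vs Vs (uses x))) ⟩
    ∑ Vs (λ x → ∑ Vs (λ u → ∑ Vs (λ y → uses x y u))) ≡⟨ ∑-swap Vs Vs (λ x u → ∑ Vs (λ y → uses x y u)) ⟩
    ∑ Vs edgeLoad                                ∎

-- Splitting off 2·3^h leaves (3 + 2h)·3^h, which covers the subtracted 4(h + 1) as soon as 3^h ≥ 3;
-- the truncated subtraction is then genuine.
index-bound : ∀ h → 2 * 3 ^ h ≤ 3 ^ h * (3 + 2 * suc h) ∸ 4 * suc h + 1
-- Both sides equal 2.
index-bound zero = ≤-refl
index-bound h@(suc g) = ≤-trans (m+n≤o⇒m≤o∸n (2 * 3 ^ h) (begin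
  2 * 3 ^ h + 4 * suc h           ≤⟨ +-monoʳ-≤ (2 * 3 ^ h) (≤-trans (4[1+h]≤ g) (*-monoʳ-≤ (3 + 2 * h) 3≤3^h)) ⟩
  2 * 3 ^ h + (3 + 2 * h) * 3 ^ h ≡⟨ expand (3 ^ h) h ⟩
  3 ^ h * (3 + 2 * suc h)         ∎)) (m≤m+n _ 1)
  where
  open ≤-Reasoning
  3≤3^h : 3 ≤ 3 ^ h
  3≤3^h = *-monoʳ-≤ 3 (m^n>0 3 g)
  4[1+h]≤ : ∀ g → 4 * suc (suc g) ≤ (3 + 2 * suc g) * 3
  4[1+h]≤ g = subst (4 * suc (suc g) ≤_) (eq g) (m≤m+n _ (7 + 2 * g))
    where
    eq : ∀ g → 4 * suc (suc g) + (7 + 2 * g) ≡ (3 + 2 * suc g) * 3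
    eq = solveℕ-∀
  expand : ∀ t h → 2 * t + (3 + 2 * h) * t ≡ t * (3 + 2 * suc h)
  expand = solveℕ-∀

theorem3p32 : (h : ℕ) → 0 < h →
    ∃[ k ] IsEdgeForwardingIndex (MC 3 h) k
    × (2 * 3 ^ (h ∸ 1) ≤ k)
    × (k ≤ 3 ^ (h ∸ 1) * (3 + 2 * h) ∸ 4 * h + 1)
theorem3p32 (suc h) _ =
  2 * 3 ^ h , ((routing , routing-load) , routing-load≥ h) , ≤-refl , index-bound h
  where open Circulant (suc h)
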